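{- There exists a finite simple undirected graph $G$ whose weak-factor series does not terminate, i.e. such that in the weak-factor series $(G_i)_{i\ge 1}$ generated by $G$, the graph $G_i$ is defined for every $i\ge 1$ and the weak-factor factorisation of every $G_i$ is effective.
   Context: All graphs are finite, undirected and simple. A $k$-partite graph $G=(V_0,\ldots,V_{k-1},E)$ is a graph together with an ordered partition $(V_0,\ldots,V_{k-1})$ of its vertex set into $k$ non-empty parts (levels) such that every edge joins vertices in different parts. $N(x)$ is the neighbourhood of $x$. Factorisation. Given a $k$-partite graph $G=(V_0,\ldots,V_{k-1},E)$ with $k\ge 2$ and a set $V'_k$ of subsets of $V(G)$, the factorisation of $G$ with respect to $V'_k$ is the graph $G'=(V_0,\ldots,V_k,E\cup E_+)$, where the new level $V_k$ is the set of inclusion-maximal elements of $V'_k$ and $E_+=\{Xy \mid X\in V_k,\ y\in X\}$. It is called effective if $V_k\neq\emptyset$. Weak-factor graph. For a $k$-partite graph, $V^+_k$ is the set of all sets $\{x_1,\ldots,x_l\}\cup\bigcap_{1\le i\le l}N(x_i)$ where $l\ge 2$, $x_1,\ldots,x_l$ are distinct elements of $V_{k-1}$, and $|\bigcap_{1\le i\le l}N(x_i)|\ge 2$. The weak-factor graph of a $k$-partite graph is its factorisation with respect to $V^+_k$. Weak-factor series of a graph $G$. $\mathcal{K}(G)$ is the set of maximal cliques of $G$. $G_1=B(G)$ is the vertex-clique-incidence bipartite graph: level $V_0=V(G)$, level $V_1=\mathcal{K}(G)$, with an edge $vC$ whenever $v\in C$. For $i\ge 1$, $G_{i+1}$ is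 the weak-factor graph of $G_i$ if that factorisation is effective, and is undefined otherwise. The series terminates if for some $i\geq 1$ the factorisation of $G_i$ is not effective. -}

module Defs where

open import Data.Fin.Base using (Fin; zero; suc; inject₁; fromℕ; splitAt; _↑ˡ_; _↑ʳ_)
import Data.Fin.Properties as Fin
open import Data.Fin.Properties using (splitAt-↑ˡ; splitAt-↑ʳ; inject₁-injective; fromℕ≢inject₁)
open import Data.Fin.Relation.Unary.Top using (view; ‵fromℕ; ‵inject₁)
open import Data.Fin.Subset
  using (Subset; inside; outside; ⊥; _∈_; _⊂_; _⊃_; _∪_; ⋂; ∣_∣; Lift)
open import Data.Fin.Subset.Induction using (⊃-wellFounded; Acc; acc)
open import Data.Fin.Subset.Properties using (_∈?_; _⊂?_; anySubset?; Lift?; ∉⊥)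
open import Data.List.Base as List using (List; []; _∷_; _++_; filter; length; allFin)
open import Data.List.Membership.Propositional using () renaming (_∈_ to _∈ˡ_)
open import Data.List.Membership.Propositional.Properties
  using (∈-map⁺; ∈-map⁻; ∈-++⁺ˡ; ∈-++⁺ʳ; ∈-filter⁺)
open import Data.List.Relation.Unary.All using ([])
open import Data.List.Relation.Unary.Any using (here)
open import Data.List.Relation.Unary.Unique.Propositional using (Unique; []; _∷_)
import Data.List.Relation.Unary.Unique.Propositional.Properties as Unique
open import Data.Maybe.Base using (Maybe; just; nothing; _>>=_)
open import Data.Nat.Base using (ℕ; zero; suc; _+_; _≤_; NonZero)
open import Data.Nat.Properties using (_≤?_)
open import Data.Product.Base using (∃; ∃-syntax; _×_; _,_)
open import Data.Sum.Base using (_⊎_; inj₁; inj₂; [_,_]′)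
open import Data.Empty using () renaming (⊥ to False)
open import Data.Vec.Base using ([]; _∷_; tabulate)
open import Data.Vec.Properties using (∷-injectiveʳ; ≡-dec)
open import Data.Bool.Properties using () renaming (_≟_ to _≟ᵇ_)
open import Function.Base using (_∘_; const)
open import Level using (0ℓ)
open import Relation.Binary.Core using (Rel)
open import Relation.Binary.Definitions using (Decidable; Symmetric; Irreflexive)
open import Relation.Binary.PropositionalEquality
open import Relation.Nullary using (Dec; yes; no; ¬_; does; contradiction)
open import Relation.Nullary.Decidable using (¬?; _×-dec_; _→-dec_)
import Relation.Unary as U
open U using (Pred)

private
  variable
    n k : ℕ

allSubsets : ∀ n → List (Subset n)
allSubsets zero    = [] ∷ []
allSubsets (suc n) =
  List.map (inside ∷_) (allSubsets n) ++ List.map (outside ∷_) (allSubsets n)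

allSubsets-complete : (p : Subset n) → p ∈ˡ allSubsets n
allSubsets-complete []            = here refl
allSubsets-complete (inside ∷ p)  = ∈-++⁺ˡ (∈-map⁺ _ (allSubsets-complete p))
allSubsets-complete (outside ∷ p) = ∈-++⁺ʳ _ (∈-map⁺ _ (allSubsets-complete p))

allSubsets-unique : ∀ n → Unique (allSubsets n)
allSubsets-unique zero    = [] ∷ []
allSubsets-unique (suc n) = Unique.++⁺
  (Unique.map⁺ ∷-injectiveʳ (allSubsets-unique n))
  (Unique.map⁺ ∷-injectiveʳ (allSubsets-unique n))
  disjoint
  where
  disjoint : ∀ {p} → p ∈ˡ List.map (inside ∷_) (allSubsets n) ×
                     p ∈ˡ List.map (outside ∷_) (allSubsets n) → False
  disjoint (a , b) with ∈-map⁻ _ a | ∈-map⁻ _ b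
  ... | _ , _ , refl | _ , _ , ()

Maximal : Pred (Subset n) 0ℓ → Pred (Subset n) 0ℓ
Maximal P X = P X × ¬ (∃[ Y ] P Y × X ⊂ Y)

maximal? : {P : Pred (Subset n) 0ℓ} → U.Decidable P → U.Decidable (Maximal P)
maximal? P? X = P? X ×-dec ¬? (anySubset? λ Y → P? Y ×-dec X ⊂? Y)

maximals : {P : Pred (Subset n) 0ℓ} → U.Decidable P → List (Subset n)
maximals P? = filter (maximal? P?) (allSubsets _)

∃-maximal : {P : Pred (Subset n) 0ℓ} → U.Decidable P → ∃ P → ∃ (Maximal P)
∃-maximal {P = P} P? (X , pX) = climb X pX (⊃-wellFounded X)
  where
  climb : ∀ X → P X → Acc _⊃_ X → ∃ (Maximal P)
  climb X pX (acc rs) with anySubset? (λ Y → P? Y ×-dec X ⊂? Y)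
  ... | yes (Y , pY , X⊂Y) = climb Y pY (rs X⊂Y)
  ... | no  none           = X , pX , none

maximals-nonEmpty : {P : Pred (Subset n) 0ℓ} (P? : U.Decidable P) →
                    ∃ P → maximals P? ≢ []
maximals-nonEmpty P? ∃P eq
  with Y , maxY ← ∃-maximal P? ∃P
  with () ← subst (Y ∈ˡ_) eq (∈-filter⁺ (maximal? P?) (allSubsets-complete Y) maxY)

-- The order is non-zero because the vertex set becomes level V₀ of the
-- vertex-clique-incidence graph, and levels are non-empty.
record SimpleGraph : Set₁ where
  field
    order       : ℕ
    {{nonZero}} : NonZero order
    _~_         : Rel (Fin order) 0ℓ
    _~?_        : Decidable _~_
    ~-sym       : Symmetric _~_
    ~-irrefl    : Irreflexive _≡_ _~_

-- The vertices are Fin order and V_i = { v ∣ level v ≡ i }.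
record MultipartiteGraph (k : ℕ) : Set₁ where
  field
    order    : ℕ
    level    : Fin order → Fin k
    nonEmpty : ∀ i → ∃[ v ] level v ≡ i
    _~_      : Rel (Fin order) 0ℓ
    _~?_     : Decidable _~_
    ~-sym    : Symmetric _~_
    ~-levels : ∀ {x y} → x ~ y → level x ≢ level y

  N : Fin order → Subset order
  N x = tabulate λ y → does (x ~? y)

-- Adds a new last level whose vertices are the (positions of the) sets in Xs,
-- each adjacent exactly to its elements.
module Adjoin (G : MultipartiteGraph k)
              (Xs : List (Subset (MultipartiteGraph.order G))) where
  private module G = MultipartiteGraph G

  V : Set
  V = Fin G.order ⊎ Fin (length Xs)

  split : Fin (G.order + length Xs) → V
  split = splitAt G.order

  levelV : V → Fin (suc k)
  levelV = [ inject₁ ∘ G.level , const (fromℕ k) ]′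

  E : Rel V 0ℓ
  E (inj₁ x) (inj₁ y) = x G.~ y
  E (inj₁ x) (inj₂ j) = x ∈ List.lookup Xs j
  E (inj₂ i) (inj₁ y) = y ∈ List.lookup Xs i
  E (inj₂ i) (inj₂ j) = False

  E? : Decidable E
  E? (inj₁ x) (inj₁ y) = x G.~? y
  E? (inj₁ x) (inj₂ j) = x ∈? List.lookup Xs j
  E? (inj₂ i) (inj₁ y) = y ∈? List.lookup Xs i
  E? (inj₂ i) (inj₂ j) = no λ ()

  E-sym : ∀ a b → E a b → E b a
  E-sym (inj₁ x) (inj₁ y) = G.~-sym
  E-sym (inj₁ x) (inj₂ j) e = e
  E-sym (inj₂ i) (inj₁ y) e = e

  E-levels : ∀ a b → E a b → levelV a ≢ levelV b
  E-levels (inj₁ x) (inj₁ y) e = G.~-levels e ∘ inject₁-injective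
  E-levels (inj₁ x) (inj₂ j) e = fromℕ≢inject₁ ∘ sym
  E-levels (inj₂ i) (inj₁ y) e = fromℕ≢inject₁

  some : Xs ≢ [] → Fin (length Xs)
  some = go Xs
    where
    go : ∀ Ys → Ys ≢ [] → Fin (length Ys)
    go []      ne = contradiction refl ne
    go (_ ∷ _) _  = zero

  occupied : Xs ≢ [] → ∀ i → ∃[ v ] levelV (split v) ≡ i
  occupied ne i with view i
  ... | ‵fromℕ     = G.order ↑ʳ some ne ,
                     cong levelV (splitAt-↑ʳ G.order (length Xs) (some ne))
  ... | ‵inject₁ j with v , eq ← G.nonEmpty j =
    v ↑ˡ length Xs ,
    trans (cong levelV (splitAt-↑ˡ G.order v (length Xs))) (cong inject₁ eq)

  adjoin : Xs ≢ [] → MultipartiteGraph (suc k)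
  adjoin ne = record
    { order    = G.order + length Xs
    ; level    = levelV ∘ split
    ; nonEmpty = occupied ne
    ; _~_      = λ u v → E (split u) (split v)
    ; _~?_     = λ u v → E? (split u) (split v)
    ; ~-sym    = λ {u} {v} → E-sym (split u) (split v)
    ; ~-levels = λ {u} {v} → E-levels (split u) (split v)
    }

open Adjoin using (adjoin)

-- A factorisation that is not effective would have an empty last level, so it
-- is only formed as a (k+1)-partite graph when it is effective.
module Factorisation (G : MultipartiteGraph (2 + k))
                     {P : Pred (Subset (MultipartiteGraph.order G)) 0ℓ}
                     (P? : U.Decidable P) where

  Effective : Set
  Effective = maximals P? ≢ []

  effective? : Dec Effective
  effective? with maximals P?
  ... | []    = no λ ne → ne refl
  ... | _ ∷ _ = yes λ ()

  factorisation : Effective → MultipartiteGraph (3 + k)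
  factorisation = adjoin G (maximals P?)

module WeakFactor (G : MultipartiteGraph (2 + k)) where
  open MultipartiteGraph G

  Last : Pred (Fin order) 0ℓ
  Last x = level x ≡ fromℕ (suc k)

  -- ⋂ N(x) over x ∈ S
  ⋂N : Subset order → Subset order
  ⋂N S = ⋂ (List.map N (filter (_∈? S) (allFin order)))

  -- S is the set {x₁, …, x_l} of distinct vertices, so l = ∣ S ∣.
  V⁺ : Pred (Subset order) 0ℓ
  V⁺ X = ∃[ S ] Lift Last S × 2 ≤ ∣ S ∣ × 2 ≤ ∣ ⋂N S ∣ × X ≡ S ∪ ⋂N S

  V⁺? : U.Decidable V⁺
  V⁺? X = anySubset? λ S →
    Lift? (λ x → level x Fin.≟ fromℕ (suc k)) S
    ×-dec 2 ≤? ∣ S ∣ ×-dec 2 ≤? ∣ ⋂N S ∣ ×-dec ≡-dec _≟ᵇ_ X (S ∪ ⋂N S)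

  open Factorisation G V⁺? public
    renaming (factorisation to weakFactorGraph)

module _ (G : SimpleGraph) where
  open SimpleGraph G

  Clique : Pred (Subset order) 0ℓ
  Clique C = ∀ x y → x ∈ C → y ∈ C → x ≢ y → x ~ y

  clique? : U.Decidable Clique
  clique? C = Fin.all? λ x → Fin.all? λ y →
    x ∈? C →-dec y ∈? C →-dec ¬? (x Fin.≟ y) →-dec x ~? y

  maximalCliques : List (Subset order)
  maximalCliques = maximals clique?

  private
    vertex : ∀ m → {{NonZero m}} → Fin m
    vertex (suc m) = zero

    edgeless : MultipartiteGraph 1
    edgeless = record
      { order    = order
      ; level    = const zero
      ; nonEmpty = λ { zero → vertex order , refl }
      ; _~_      = λ _ _ → False
      ; _~?_     = λ _ _ → no λ ()
      ; ~-sym    = λ ()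
      ; ~-levels = λ ()
      }

  B : MultipartiteGraph 2
  B = adjoin edgeless maximalCliques
    (maximals-nonEmpty clique? (⊥ , λ _ _ x∈⊥ → contradiction x∈⊥ ∉⊥))

weakFactorStep : MultipartiteGraph (2 + k) → Maybe (MultipartiteGraph (3 + k))
weakFactorStep G with WeakFactor.effective? G
... | yes e = just (WeakFactor.weakFactorGraph G e)
... | no  _ = nothing

-- weakFactorSeries G i is G_{i+1}, which has i+2 levels; nothing means undefined.
weakFactorSeries : SimpleGraph → (i : ℕ) → Maybe (MultipartiteGraph (2 + i))
weakFactorSeries G zero    = just (B G)
weakFactorSeries G (suc i) = weakFactorSeries G i >>= weakFactorStep

{-# OPTIONS --safe #-}
-- Suppose the last level contains three vertices x₀, x₁, x₂ with a common
-- neighbour a, and vertices w₀, w₁, w₂ such that wᵢ is adjacent to xⱼ exactly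
-- when i ≠ j. Any two of the xᵢ share a and one w, hence some weak factor Xᵢ
-- contains { xⱼ ∣ j ≠ i } and its common neighbours a and wᵢ. It omits xᵢ,
-- because xᵢ is not adjacent to wᵢ. So X₀, X₁, X₂ form such a configuration
-- again, with the same a and with the xᵢ in the role of the wᵢ. A cone over
-- the 3-sun starts the recursion.
module Submission where

open import Data.Fin.Base using (Fin; zero; suc; fromℕ; punchIn; punchOut; _↑ˡ_; _↑ʳ_)
open import Data.Fin.Properties
  using (_≟_; all?; any?; punchInᵢ≢i; punchIn-injective; punchIn-punchOut; splitAt-↑ˡ; splitAt-↑ʳ)
open import Data.Fin.Subset
  using (Subset; inside; _∈_; _∉_; _⊆_; _∪_; ∁; ⁅_⁆; Nonempty; ∣_∣; ⋂; Lift)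
open import Data.Fin.Subset.Properties
  using (_∈?_; _⊆?_; x∈⁅x⁆; x∈⁅y⁆⇒x≡y; ∣⁅x⁆∣≡1; ∣⊥∣≡0; nonempty?; Empty-unique; p⊂q⇒∣p∣<∣q∣; p⊆p∪q; q⊆p∪q; x∈p∪q⁻;
         x∈p∩q⁺; p∩q⊆p; p∩q⊆q; ∈⊤; ⊆-trans)
open import Data.List.Base as List using (List; []; _∷_; filter; length; allFin)
open import Data.List.Membership.Propositional using () renaming (_∈_ to _∈ˡ_)
open import Data.List.Membership.Propositional.Properties
  using (∈-allFin; ∈-filter⁺; ∈-filter⁻; ∈-map⁺; ∈-map⁻)
open import Data.List.Relation.Unary.Any using (here; there; index)
open import Data.List.Relation.Unary.Any.Properties using (lookup-index)
open import Data.Maybe.Base using (just; _>>=_)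
open import Data.Nat.Base using (ℕ; zero; suc; _+_; _≤_; _<_)
open import Data.Nat.Properties using (<⇒≤; >⇒≢)
open import Data.Product.Base using (Σ-syntax; ∃-syntax; _×_; _,_; proj₁; proj₂)
open import Data.Sum.Base using (inj₁; inj₂)
open import Data.Vec.Base using (_∷_; _++_; here)
open import Data.Vec.Properties using ([]=⇒lookup; lookup⇒[]=; lookup∘tabulate)
open import Function.Base using (id; _∘_; _$_)
open import Level using (0ℓ)
open import Relation.Binary.PropositionalEquality
open import Relation.Nullary using (yes; no; ¬_; does; contradiction)
open import Relation.Nullary.Decidable using (¬?; _×-dec_; _→-dec_; dec-true; toWitness)
open import Relation.Unary as U using (Pred)

open import Defs

private
  variable
    n k : ℕ

-- Finite subsets, intersections and neighbourhoods.

2≤∣p∣ : ∀ {p : Subset n} {x y} → x ∈ p → y ∈ p → x ≢ y → 2 ≤ ∣ p ∣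
2≤∣p∣ {p = p} {x} {y} x∈p y∈p x≢y =
  subst (_< ∣ p ∣) (∣⁅x⁆∣≡1 x) $ p⊂q⇒∣p∣<∣q∣
    ( (λ z∈⁅x⁆ → subst (_∈ p) (sym (x∈⁅y⁆⇒x≡y x z∈⁅x⁆)) x∈p)
    , y , y∈p , x≢y ∘ sym ∘ x∈⁅y⁆⇒x≡y x )

0<∣p∣⇒Nonempty : ∀ (p : Subset n) → 0 < ∣ p ∣ → Nonempty p
0<∣p∣⇒Nonempty {n} p 0<∣p∣ with nonempty? p
... | yes ne = ne
... | no  ¬ne = contradiction (trans (cong ∣_∣ (Empty-unique ¬ne)) (∣⊥∣≡0 n)) (>⇒≢ 0<∣p∣)

∈⋂⁺ : ∀ {x : Fin n} (ps : List (Subset n)) → (∀ {p} → p ∈ˡ ps → x ∈ p) → x ∈ ⋂ ps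
∈⋂⁺ []       x∈ps = ∈⊤
∈⋂⁺ (p ∷ ps) x∈ps = x∈p∩q⁺ (x∈ps (here refl) , ∈⋂⁺ ps (x∈ps ∘ there))

∈⋂⁻ : ∀ {x : Fin n} {ps p} → x ∈ ⋂ ps → p ∈ˡ ps → x ∈ p
∈⋂⁻ {ps = p ∷ ps} x∈ (here refl) = p∩q⊆p p (⋂ ps) x∈
∈⋂⁻ {ps = p ∷ ps} x∈ (there q∈)  = ∈⋂⁻ (p∩q⊆q p (⋂ ps) x∈) q∈

-- Maximise among the `P`-sets that contain `X`: a strictly larger `P`-set still contains `X`, so
-- the result is maximal among all `P`-sets.
∃-maximal-above : ∀ {P : Pred (Subset n) 0ℓ} (P? : U.Decidable P) {X} → P X →
                  ∃[ Y ] Y ∈ˡ maximals P? × P Y × X ⊆ Y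
∃-maximal-above P? {X} pX
  with Y , (pY , X⊆Y) , top ← ∃-maximal (λ Z → P? Z ×-dec X ⊆? Z) (X , pX , λ x∈X → x∈X) =
  Y , ∈-filter⁺ (maximal? P?) (allSubsets-complete Y) (pY , maximal) , pY , X⊆Y
  where
  maximal : ¬ (∃[ Z ] _)
  maximal (Z , pZ , Y⊂Z) = top (Z , (pZ , ⊆-trans X⊆Y (proj₁ Y⊂Z)) , Y⊂Z)

module _ (G : MultipartiteGraph k) where
  open MultipartiteGraph G

  ∈N⁺ : ∀ {x y} → x ~ y → y ∈ N x
  ∈N⁺ {x} {y} x~y = lookup⇒[]= y (N x) (trans (lookup∘tabulate _ y) (dec-true (x ~? y) x~y))

  ∈N⁻ : ∀ {x y} → y ∈ N x → x ~ y
  ∈N⁻ {x} {y} y∈N with x ~? y | trans (sym (lookup∘tabulate (λ z → does (x ~? z)) y)) ([]=⇒lookup y∈N)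
  ... | yes x~y | _  = x~y
  ... | no  _   | ()

-- Configurations and the adjunction of a level.

record Configuration (G : MultipartiteGraph (suc k)) : Set where
  open MultipartiteGraph G
  field
    a      : Fin order
    w x    : Fin 3 → Fin order
    x-last : ∀ i → level (x i) ≡ fromℕ k
    x~a    : ∀ i → x i ~ a
    x~w    : ∀ {i j} → i ≢ j → x j ~ w i
    x≁w    : ∀ i → ¬ (x i ~ w i)

module _ (G : MultipartiteGraph k) (Xs : List (Subset (MultipartiteGraph.order G))) where
  open MultipartiteGraph G using (order)
  open Adjoin G Xs

  E-new-old : ∀ i v → E (split (order ↑ʳ i)) (split (v ↑ˡ length Xs)) ≡ (v ∈ List.lookup Xs i)
  E-new-old i v = cong₂ E (splitAt-↑ʳ order (length Xs) i) (splitAt-↑ˡ order v (length Xs))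

  -- Adjacency between a new and an old vertex is membership, so a configuration on the new level
  -- amounts to a membership pattern of old vertices in three of the sets. This serves both the
  -- initial clique graph and every weak-factor step.
  adjoin-configuration :
    (ne : Xs ≢ []) (a : Fin order) (w : Fin 3 → Fin order) (X : Fin 3 → Subset order) →
    (∀ i → X i ∈ˡ Xs) → (∀ i → a ∈ X i) → (∀ {i j} → i ≢ j → w i ∈ X j) → (∀ i → w i ∉ X i) →
    Configuration (adjoin ne)
  adjoin-configuration ne a w X X∈Xs a∈X w∈X w∉X = record
    { a      = old a
    ; w      = old ∘ w
    ; x      = new
    ; x-last = λ i → cong levelV (splitAt-↑ʳ order (length Xs) (index (X∈Xs i)))
    ; x~a    = λ i → adjacent i (a∈X i)
    ; x~w    = λ {_} {j} → adjacent j ∘ w∈X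
    ; x≁w    = λ i e → w∉X i
        (subst (w i ∈_) (sym (lookup-index (X∈Xs i))) (subst id (E-new-old _ _) e))
    }
    where
    old : Fin order → Fin _
    old v = v ↑ˡ length Xs

    new : Fin 3 → Fin _
    new i = order ↑ʳ index (X∈Xs i)

    adjacent : ∀ i {v} → v ∈ X i → E (split (new i)) (split (old v))
    adjacent i {v} v∈X = subst id (sym (E-new-old _ _))
      (subst (v ∈_) (lookup-index (X∈Xs i)) v∈X)

-- Weak factors of a configuration.

module _ (G : MultipartiteGraph (2 + k)) where
  open MultipartiteGraph G
  open WeakFactor G

  ∈⋂N⁺ : ∀ {S v} → (∀ {s} → s ∈ S → s ~ v) → v ∈ ⋂N S
  ∈⋂N⁺ {S} {v} S~v = ∈⋂⁺ _ member
    where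
    member : ∀ {p} → p ∈ˡ List.map N (filter (_∈? S) (allFin order)) → v ∈ p
    member p∈ with s , s∈ , refl ← ∈-map⁻ N p∈ =
      ∈N⁺ G (S~v (proj₂ (∈-filter⁻ (_∈? S) {xs = allFin order} s∈)))

  ∈⋂N⁻ : ∀ {S v s} → v ∈ ⋂N S → s ∈ S → s ~ v
  ∈⋂N⁻ {S} {s = s} v∈ s∈S = ∈N⁻ G (∈⋂⁻ v∈ (∈-map⁺ N (∈-filter⁺ (_∈? S) (∈-allFin s) s∈S)))

  Last≁Last : ∀ {u v} → Last u → Last v → ¬ (u ~ v)
  Last≁Last u-last v-last u~v = ~-levels u~v (trans u-last (sym v-last))

  -- Write `X` as `T ∪ ⋂N T`. The last level has no inner edges, so its vertices in `X` avoid `⋂N T`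
  -- and lie in `T`, while vertices of `⋂N S` avoid the last level and so lie in `⋂N T`. The two
  -- kinds are therefore adjacent; this is what later keeps `x i` out of its own factor.
  weakFactor-above :
    ∀ {S s} → s ∈ S → Lift Last S → 2 ≤ ∣ S ∣ → 2 ≤ ∣ ⋂N S ∣ →
    ∃[ X ] X ∈ˡ maximals V⁺? × S ⊆ X × ⋂N S ⊆ X ×
      (∀ {z v} → Last z → z ∈ X → v ∈ ⋂N S → z ~ v)
  weakFactor-above {S} {s} s∈S S-last 2≤S 2≤N
    with X , X∈ , (T , T-last , 2≤T , _ , refl) , S∪N⊆X ←
         ∃-maximal-above V⁺? (S , S-last , 2≤S , 2≤N , refl)
    with t , t∈T ← 0<∣p∣⇒Nonempty T (<⇒≤ 2≤T) =
    X , X∈ , S∪N⊆X ∘ p⊆p∪q _ , N⊆X , adjacent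
    where
    N⊆X : ⋂N S ⊆ X
    N⊆X = S∪N⊆X ∘ q⊆p∪q S _

    last∈T : ∀ {z} → Last z → z ∈ X → z ∈ T
    last∈T z-last z∈X with x∈p∪q⁻ T (⋂N T) z∈X
    ... | inj₁ z∈T = z∈T
    ... | inj₂ z∈N = contradiction (∈⋂N⁻ z∈N t∈T) (Last≁Last (T-last t∈T) z-last)

    adjacent : ∀ {z v} → Last z → z ∈ X → v ∈ ⋂N S → z ~ v
    adjacent z-last z∈X v∈N with x∈p∪q⁻ T (⋂N T) (N⊆X v∈N)
    ... | inj₁ v∈T = contradiction (∈⋂N⁻ v∈N s∈S) (Last≁Last (S-last s∈S) (T-last v∈T))
    ... | inj₂ v∈N = ∈⋂N⁻ v∈N (last∈T z-last z∈X)

  module _ (C : Configuration G) where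
    open Configuration C

    -- The vertex `w i` separates them: it is adjacent to `x j` but not to `x i`.
    x-injective : ∀ {i j} → i ≢ j → x i ≢ x j
    x-injective {i} i≢j xᵢ≡xⱼ = x≁w i (subst (_~ w i) (sym xᵢ≡xⱼ) (x~w i≢j))

    -- `punchIn i` enumerates the two indices of `Fin 3` that differ from `i`.
    others : Fin 3 → Subset order
    others i = ⁅ x (punchIn i zero) ⁆ ∪ ⁅ x (punchIn i (suc zero)) ⁆

    x∈others : ∀ {i j} → i ≢ j → x j ∈ others i
    x∈others {i} i≢j = subst (λ j → x j ∈ others i) (punchIn-punchOut i≢j) (member (punchOut i≢j))
      where
      member : ∀ m → x (punchIn i m) ∈ others i
      member zero       = p⊆p∪q _ (x∈⁅x⁆ _)
      member (suc zero) = q⊆p∪q ⁅ x (punchIn i zero) ⁆ _ (x∈⁅x⁆ _)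

    others⇒x : ∀ i {v} → v ∈ others i → ∃[ j ] i ≢ j × v ≡ x j
    others⇒x i v∈ with x∈p∪q⁻ _ _ v∈
    ... | inj₁ v∈⁅⁆ = _ , punchInᵢ≢i i zero ∘ sym , x∈⁅y⁆⇒x≡y _ v∈⁅⁆
    ... | inj₂ v∈⁅⁆ = _ , punchInᵢ≢i i (suc zero) ∘ sym , x∈⁅y⁆⇒x≡y _ v∈⁅⁆

    others~ : ∀ i {v} → (∀ {j} → i ≢ j → x j ~ v) → v ∈ ⋂N (others i)
    others~ i {v} x~v = ∈⋂N⁺ adjacent
      where
      adjacent : ∀ {s} → s ∈ others i → s ~ v
      adjacent s∈ with j , i≢j , refl ← others⇒x i s∈ = x~v i≢j

    a∈⋂N : ∀ i → a ∈ ⋂N (others i)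
    a∈⋂N i = others~ i λ {j} _ → x~a j

    w∈⋂N : ∀ i → w i ∈ ⋂N (others i)
    w∈⋂N i = others~ i x~w

    others-last : ∀ i → Lift Last (others i)
    others-last i v∈ with j , _ , refl ← others⇒x i v∈ = x-last j

    2≤others : ∀ i → 2 ≤ ∣ others i ∣
    2≤others i = 2≤∣p∣ (p⊆p∪q _ (x∈⁅x⁆ _)) (q⊆p∪q ⁅ x (punchIn i zero) ⁆ _ (x∈⁅x⁆ _))
      (x-injective λ eq → contradiction (punchIn-injective i _ _ eq) λ ())

    -- The common neighbours `a` and `w i` differ because `x i` is adjacent to the former only.
    2≤⋂N : ∀ i → 2 ≤ ∣ ⋂N (others i) ∣
    2≤⋂N i = 2≤∣p∣ (a∈⋂N i) (w∈⋂N i) λ a≡w → x≁w i (subst (x i ~_) a≡w (x~a i))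

    configuration⇒effective : Effective
    configuration⇒effective = maximals-nonEmpty V⁺?
      (_ , others zero , others-last zero , 2≤others zero , 2≤⋂N zero , refl)

    weakFactor-configuration : (e : Effective) → Configuration (weakFactorGraph e)
    weakFactor-configuration e = adjoin-configuration G (maximals V⁺?) e a x X
      (λ i → proj₁ (proj₂ (factor i)))
      (λ i → ⋂N⊆X i (a∈⋂N i))
      (λ i≢j → others⊆X _ (x∈others (i≢j ∘ sym)))
      -- If `X i` contained `x i`, then `x i` would be adjacent to every common neighbour of
      -- `others i`, in particular to `w i`.
      (λ i xᵢ∈Xᵢ → x≁w i (adjacent i (x-last i) xᵢ∈Xᵢ (w∈⋂N i)))
      where
      factor : ∀ i → _
      -- The first argument merely exhibits a member of `others i`.
      factor i = weakFactor-above (x∈others (punchInᵢ≢i i zero ∘ sym)) (others-last i)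
        (2≤others i) (2≤⋂N i)

      X : Fin 3 → Subset order
      X i = proj₁ (factor i)

      others⊆X : ∀ i → others i ⊆ X i
      others⊆X i = proj₁ (proj₂ (proj₂ (factor i)))

      ⋂N⊆X : ∀ i → ⋂N (others i) ⊆ X i
      ⋂N⊆X i = proj₁ (proj₂ (proj₂ (proj₂ (factor i))))

      adjacent : ∀ i {z v} → Last z → z ∈ X i → v ∈ ⋂N (others i) → z ~ v
      adjacent i = proj₂ (proj₂ (proj₂ (proj₂ (factor i))))

step-configuration : (G : MultipartiteGraph (2 + k)) → Configuration G →
                     ∃[ H ] weakFactorStep G ≡ just H × Configuration H
step-configuration G C with WeakFactor.effective? G
... | yes e = _ , refl , weakFactor-configuration G C e
... | no ¬e = contradiction (configuration⇒effective G C) ¬e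

-- Vertex zero is the apex a, then come w₀, w₁, w₂ and p₀, p₁, p₂; this is the
-- clique on a, pᵢ and the wⱼ with j ≠ i.
clique : Fin 3 → Subset 7
clique i = inside ∷ (∁ ⁅ i ⁆ ++ ⁅ i ⁆)

-- Edges are the pairs covered by some `clique i`; these also cover the clique on the apex and all
-- three `w`s, since any two `w`s share the clique of the third index.
cone : SimpleGraph
cone = record
  { order    = 7
  ; _~_      = λ u v → u ≢ v × (∃[ i ] u ∈ clique i × v ∈ clique i)
  ; _~?_     = λ u v → ¬? (u ≟ v) ×-dec any? (λ i → u ∈? clique i ×-dec v ∈? clique i)
  ; ~-sym    = λ (u≢v , i , u∈ , v∈) → u≢v ∘ sym , i , v∈ , u∈
  ; ~-irrefl = λ u≡v (u≢v , _) → u≢v u≡v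
  }

cone-configuration : Configuration (B cone)
cone-configuration = adjoin-configuration _ (maximalCliques cone) _ zero w clique
  clique∈ (λ _ → here)
  -- The membership pattern of the `w i` in the cliques is decided by evaluation over `Fin 3`.
  (λ {i} {j} → toWitness {a? = all? λ i → all? λ j → ¬? (i ≟ j) →-dec w i ∈? clique j} _ i j)
  (toWitness {a? = all? λ i → ¬? (w i ∈? clique i)} _)
  where
  w p : Fin 3 → Fin 7
  w i = suc (i ↑ˡ 3)
  p i = suc (3 ↑ʳ i)

  p∈clique : ∀ i → p i ∈ clique i
  p∈clique = toWitness {a? = all? λ i → p i ∈? clique i} _

  -- Each `p i` is private to its clique, so every edge at `p i` comes from `clique i`.
  p∈clique⇒≡ : ∀ i j → p i ∈ clique j → i ≡ j
  p∈clique⇒≡ = toWitness {a? = all? λ i → all? λ j → p i ∈? clique j →-dec i ≟ j} _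

  -- clique i is the closed neighbourhood of pᵢ.
  within : ∀ i {Y} → Clique cone Y → p i ∈ Y → Y ⊆ clique i
  within i Y-clique pᵢ∈Y {y} y∈Y with p i ≟ y
  ... | yes refl = p∈clique i
  ... | no  pᵢ≢y
    with _ , j , pᵢ∈ , y∈ ← Y-clique (p i) y pᵢ∈Y y∈Y pᵢ≢y
    with refl ← p∈clique⇒≡ i j pᵢ∈ = y∈

  -- A strictly larger clique would contain `p i`, hence lie within `clique i`.
  clique∈ : ∀ i → clique i ∈ˡ maximalCliques cone
  clique∈ i = ∈-filter⁺ (maximal? (clique? cone)) (allSubsets-complete (clique i))
    ( (λ u v u∈ v∈ u≢v → u≢v , i , u∈ , v∈)
    , λ (Y , Y-clique , C⊆Y , y , y∈Y , y∉C) →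
        y∉C (within i {Y} Y-clique (C⊆Y (p∈clique i)) y∈Y) )

-- Non-termination of the series.

-- The induction carries a configuration because it both forces effectiveness and reproduces itself
-- in the next graph.
series-configuration : ∀ i → ∃[ H ] weakFactorSeries cone i ≡ just H × Configuration H
series-configuration zero    = B cone , refl , cone-configuration
series-configuration (suc i)
  with G , G-eq , C ← series-configuration i
  with H , H-eq , D ← step-configuration G C =
  H , trans (cong (_>>= weakFactorStep) G-eq) H-eq , D

mainTheorem4 : Σ[ G ∈ SimpleGraph ]
    ((i : ℕ) → ∃[ H ] (weakFactorSeries G i ≡ just H × WeakFactor.Effective H))
mainTheorem4 = cone , λ i →
  let H , H-eq , C = series-configuration i in H , H-eq , configuration⇒effective H C
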